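{- Let $n,k$ be integers with $2<2k\le n$ such that $\mathrm{Pet}(n,k)$ is non-bipartite. Then either $g_{odd}(\mathrm{Pet}(n,k))=k+3$, or $$\max\Big(\frac{n}{k},\ \min\{\gcd(n,k-1),\gcd(n,k+1)\}+2\Big)\ \le\ g_{odd}(\mathrm{Pet}(n,k))\ \le\ \frac{n}{k}\,\mathrm{par}(k)+k+1,$$ where $\mathrm{par}(k)=1$ if $k$ is odd and $\mathrm{par}(k)=0$ if $k$ is even.
   Context: For integers $n,k$ with $2<2k\le n$, the generalized Petersen graph $\mathrm{Pet}(n,k)$ has vertex set $\{u_0,\dots,u_{n-1}\}\cup\{v_0,\dots,v_{n-1}\}$ and edge set $\{u_iu_{i+1}\}\cup\{u_iv_i\}\cup\{v_iv_{i+k}\}$, $i\in\{0,\dots,n-1\}$, with indices taken modulo $n$. For a non-bipartite graph $G$, the odd girth $g_{odd}(G)$ is the length of a shortest odd cycle of $G$. -}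

module Defs where

open import Data.Bool using (Bool)
open import Data.Empty using (⊥)
open import Data.Fin using (Fin; toℕ)
open import Data.Fin.Properties using (nonZeroIndex; toℕ<n; toℕ-fromℕ<)
open import Data.Integer using (+_)
open import Data.Nat
open import Data.Nat.Divisibility using (_∣_)
open import Data.Nat.DivMod using (_mod_; m%n<n; m<n⇒m%n≡m; m≤n⇒[n∸m]%m≡n%m)
open import Data.Nat.Properties
open import Data.Product using (Σ-syntax; _×_)
open import Data.Rational using (ℚ) renaming (_/_ to _/ℚ_)
open import Function.Definitions using (Injective)
open import Level using (0ℓ)
open import Relation.Binary.Construct.Closure.Symmetric
  using (SymClosure; fwd; bwd; symmetric)
open import Relation.Binary.Core using (Rel)
open import Relation.Binary.Definitions using (Symmetric)
open import Relation.Binary.PropositionalEquality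
open import Relation.Nullary using (¬_; yes; no)

record SimpleGraph : Set₁ where
  field
    Vertex     : Set
    Adj        : Rel Vertex 0ℓ
    adj-sym    : Symmetric Adj
    adj-irrefl : ∀ {x} → ¬ Adj x x

open SimpleGraph public

Bipartite : SimpleGraph → Set
Bipartite G = Σ[ f ∈ (Vertex G → Bool) ] (∀ x y → Adj G x y → f x ≢ f y)

infixl 6 _⊕_

-- Addition modulo n.  An index i : Fin n witnesses that n is nonzero.
_⊕_ : ∀ {n} → Fin n → ℕ → Fin n
_⊕_ {n} i m = _mod_ (toℕ i + m) n {{nonZeroIndex i}}

record Cycle (G : SimpleGraph) (ℓ : ℕ) : Set where
  field
    3≤length : 3 ≤ ℓ
    vertex   : Fin ℓ → Vertex G
    distinct : Injective _≡_ _≡_ vertex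
    adjacent : ∀ i → Adj G (vertex i) (vertex (i ⊕ 1))

OddCycle : SimpleGraph → ℕ → Set
OddCycle G ℓ = ¬ (2 ∣ ℓ) × Cycle G ℓ

IsOddGirth : SimpleGraph → ℕ → Set
IsOddGirth G g = OddCycle G g × (∀ ℓ → OddCycle G ℓ → g ≤ ℓ)

data PetVertex (n : ℕ) : Set where
  u v : Fin n → PetVertex n

data PetEdge (n k : ℕ) : Rel (PetVertex n) 0ℓ where
  outer : ∀ i → PetEdge n k (u i) (u (i ⊕ 1))
  spoke : ∀ i → PetEdge n k (u i) (v i)
  inner : ∀ i → PetEdge n k (v i) (v (i ⊕ k))

⊕-moves : ∀ {n} (i : Fin n) m → 0 < m → m < n → i ≢ i ⊕ m
⊕-moves {n} i m 0<m m<n i≡ = by-cases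
  where
  instance
    n≢0 : NonZero n
    n≢0 = nonZeroIndex i

  fixed : toℕ i ≡ (toℕ i + m) % n
  fixed = trans (cong toℕ i≡) (toℕ-fromℕ< (m%n<n (toℕ i + m) n))

  by-cases : ⊥
  by-cases with toℕ i + m <? n
  ... | yes i+m<n =
    <⇒≢ (m<m+n (toℕ i) 0<m) (trans fixed (m<n⇒m%n≡m i+m<n))
  ... | no  i+m≮n = <⇒≢ drop<i (sym (trans fixed reduced))
    where
    n≤i+m : n ≤ toℕ i + m
    n≤i+m = ≮⇒≥ i+m≮n

    drop<i : toℕ i + m ∸ n < toℕ i
    drop<i = +-cancelʳ-< n _ _
      (subst (_< toℕ i + n) (sym (m∸n+n≡m n≤i+m)) (+-monoʳ-< (toℕ i) m<n))

    reduced : (toℕ i + m) % n ≡ toℕ i + m ∸ n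
    reduced = trans (sym (m≤n⇒[n∸m]%m≡n%m n≤i+m))
                    (m<n⇒m%n≡m (<-trans drop<i (toℕ<n i)))

u-injective : ∀ {n} {i j : Fin n} → u i ≡ u j → i ≡ j
u-injective refl = refl

v-injective : ∀ {n} {i j : Fin n} → v i ≡ v j → i ≡ j
v-injective refl = refl

petEdge-≢ : ∀ {n k} → 2 < 2 * k → 2 * k ≤ n →
            ∀ {x y} → PetEdge n k x y → x ≢ y
petEdge-≢ {n} {k} 2<2k 2k≤n = moves
  where
  1<k : 1 < k
  1<k = *-cancelˡ-< 2 1 k 2<2k

  k<n : k < n
  k<n = <-≤-trans (m<m+n k (<-≤-trans (<-trans z<s 1<k) (m≤m+n k 0))) 2k≤n

  moves : ∀ {x y} → PetEdge n k x y → x ≢ y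
  moves (outer i) eq = ⊕-moves i 1 z<s (<-trans 1<k k<n) (u-injective eq)
  moves (spoke i) ()
  moves (inner i) eq = ⊕-moves i k (<-trans z<s 1<k) k<n (v-injective eq)

-- A simple graph even for n = 2k: the edges vᵢvᵢ₊ₖ and vᵢ₊ₖvᵢ then coincide, and
-- the inner vertices have degree 2.
Pet : ∀ n k → 2 < 2 * k → 2 * k ≤ n → SimpleGraph
Pet n k 2<2k 2k≤n = record
  { Vertex     = PetVertex n
  ; Adj        = SymClosure (PetEdge n k)
  ; adj-sym    = symmetric (PetEdge n k)
  ; adj-irrefl = λ where
      (fwd e) → petEdge-≢ 2<2k 2k≤n e refl
      (bwd e) → petEdge-≢ 2<2k 2k≤n e refl
  }

par : ℕ → ℕ
par k = k % 2

fromℕ : ℕ → ℚ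
fromℕ m = + m /ℚ 1

{-# OPTIONS --safe #-}

-- A closed walk whose net numbers of outer and inner steps are X and Y satisfies n ∣ X + kY;
-- it uses an even number of spokes, so for odd length X + Y and X − Y are odd.  If X + kY ≠ 0,
-- then n ≤ k(|X| + |Y|).  If X + kY = 0, then k is even, Y ≠ 0, |X| ≥ k, and the walk uses at
-- least two spokes, so its length is at least k + 3.  Moreover gcd(n,k−1) divides X + Y and
-- gcd(n,k+1) divides X − Y, so both are odd and at most the length; they are equal only if
-- both are 1, and otherwise the larger exceeds the smaller by at least 2.
-- For the upper bound, k even gives a closed walk of length k + 3, while for n and k odd and
-- n = qk + r the walk with q inner steps, r outer steps and two spokes is closed and odd.

module Submission where

open import Defs
open import Data.Integer using (+_)
open import Data.Nat using (ℕ; NonZero; _+_; _*_; _∸_; _<_; _≤_; _⊓_)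
open import Data.Nat.GCD using (gcd)
open import Data.Product using (_×_; ∃-syntax)
open import Data.Rational using (_/_) renaming (_+_ to _+ℚ_; _*_ to _*ℚ_; _≤_ to _≤ℚ_; _⊔_ to _⊔ℚ_)
open import Data.Sum using (_⊎_)
open import Relation.Binary.PropositionalEquality using (_≡_)
open import Relation.Nullary using (¬_)

open import Data.Fin using (Fin; toℕ)
import Data.Fin as Fin
import Data.Fin.Properties as Fin
open import Data.Integer using (ℤ; -[1+_]; 0ℤ; 1ℤ; -1ℤ; +≤+)
import Data.Integer as ℤ
open import Data.Integer.Divisibility.Signed as ℤ∣ using () renaming (_∣_ to _ℤ∣_)
import Data.Integer.Properties as ℤ
import Data.Integer.Tactic.RingSolver as ℤ-Solver
open import Data.Nat using (zero; suc; z≤n; s≤s; _%_; ≢-nonZero; >-nonZero) renaming (_/_ to _/ℕ_)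
open import Data.Nat.Divisibility
open import Data.Nat.DivMod using (m%n<n; m<n⇒m%n≡m; n%n≡0; m≡m%n+[m/n]*n; m/n*n≤m; [m+kn]%n≡m%n)
open import Data.Nat.GCD using (gcd[m,n]∣m; gcd[m,n]∣n)
open import Data.Nat.Induction using (<-rec)
open import Data.Nat.Properties hiding (⊔-lub)
import Data.Nat.Tactic.RingSolver as ℕ-Solver
open import Data.Product using (∃; _,_; proj₁; proj₂)
open import Data.Rational using (toℚᵘ; fromℚᵘ)
open import Data.Rational.Properties using (toℚᵘ-cancel-≤; toℚᵘ-fromℚᵘ; toℚᵘ-homo-+; toℚᵘ-homo-*; ⊔-lub)
open import Data.Rational.Unnormalised as ℚᵘ using (mkℚᵘ; *≤*)
import Data.Rational.Unnormalised.Properties as ℚᵘ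
open import Data.Sum using (inj₁; inj₂; [_,_]′)
open import Function using (_∘_)
open import Relation.Binary.Construct.Closure.Symmetric using (fwd; bwd)
open import Relation.Binary.Definitions using (DecidableEquality; tri<; tri≈; tri>)
open import Relation.Binary.PropositionalEquality
open import Relation.Nullary using (Dec; yes; no; does; contradiction; map′; _×-dec_; _⊎-dec_; ¬?)
open import Relation.Unary using (Decidable)

-- Well-ordering for decidable predicates

least : ∀ {P : ℕ → Set} → Decidable P → ∀ m → P m → ∃[ l ] P l × (∀ j → P j → l ≤ j)
least {P} P? = <-rec _ go
  where
  go : ∀ m → (∀ {j} → j < m → P j → ∃[ l ] P l × (∀ j → P j → l ≤ j)) →
       P m → ∃[ l ] P l × (∀ j → P j → l ≤ j)
  go m rec pm with anyUpTo? P? m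
  ... | yes (j , j<m , pj) = rec j<m pj
  ... | no  ∄              = m , pm , λ j pj → ≮⇒≥ (λ j<m → ∄ (j , j<m , pj))

-- Parity

even-or-odd : ∀ m → 2 ∣ m ⊎ 2 ∣ suc m
even-or-odd zero    = inj₁ (2 ∣0)
even-or-odd (suc m) with even-or-odd m
... | inj₁ 2∣m   = inj₂ (∣m∣n⇒∣m+n ∣-refl 2∣m)
... | inj₂ 2∣1+m = inj₁ 2∣1+m

odd⇒even-suc : ∀ {m} → ¬ 2 ∣ m → 2 ∣ suc m
odd⇒even-suc {m} 2∤m = [ (λ 2∣m → contradiction 2∣m 2∤m) , (λ 2∣1+m → 2∣1+m) ]′ (even-or-odd m)

odd⇒suc-odd : ∀ {m} → 2 ∣ m → ¬ 2 ∣ suc m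
odd⇒suc-odd {m} 2∣m 2∣1+m with ∣1⇒≡1 (∣m+n∣m⇒∣n (subst (2 ∣_) (+-comm 1 m) 2∣1+m) 2∣m)
... | ()

odd+odd : ∀ {a b} → ¬ 2 ∣ a → ¬ 2 ∣ b → 2 ∣ a + b
odd+odd {a} {b} 2∤a 2∤b = ∣m+n∣m⇒∣n {2} {2}
  (subst (2 ∣_) (cong suc (+-suc a b)) (∣m∣n⇒∣m+n (odd⇒even-suc 2∤a) (odd⇒even-suc 2∤b)))
  ∣-refl

2∣m+m : ∀ m → 2 ∣ m + m
2∣m+m m = subst (2 ∣_) (cong (λ t → m + t) (+-identityʳ m)) (m∣m*n m)

-- The successor of an odd `a` is even, so it cannot equal the odd `b`.
odd<odd⇒2+≤ : ∀ {a b} → ¬ 2 ∣ a → ¬ 2 ∣ b → a < b → a + 2 ≤ b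
odd<odd⇒2+≤ {a} {b} 2∤a 2∤b a<b = subst (_≤ b) (+-comm 2 a)
  (≤∧≢⇒< a<b (λ 1+a≡b → 2∤b (subst (2 ∣_) 1+a≡b (odd⇒even-suc 2∤a))))

-- Arithmetic modulo n

module _ {n : ℕ} where

  toℕ-⊕ : ∀ (i : Fin n) m → toℕ (i ⊕ m) ≡ _%_ (toℕ i + m) n {{Fin.nonZeroIndex i}}
  toℕ-⊕ i m = Fin.toℕ-fromℕ< (m%n<n (toℕ i + m) n {{Fin.nonZeroIndex i}})

  ⊕-quotient : ∀ (i : Fin n) m → ∃[ q ] toℕ i + m ≡ toℕ (i ⊕ m) + q * n
  ⊕-quotient i m = (toℕ i + m) /ℕ n ,
    trans (m≡m%n+[m/n]*n (toℕ i + m) n) (cong (λ t → t + (toℕ i + m) /ℕ n * n) (sym (toℕ-⊕ i m)))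
    where instance _ = Fin.nonZeroIndex i

  ⊕-0 : ∀ (i : Fin n) → i ⊕ 0 ≡ i
  ⊕-0 i = Fin.toℕ-injective
    (trans (toℕ-⊕ i 0) (trans (cong (_% n) (+-identityʳ (toℕ i))) (m<n⇒m%n≡m (Fin.toℕ<n i))))
    where instance _ = Fin.nonZeroIndex i

  ⊕-assoc : ∀ (i : Fin n) a b → (i ⊕ a) ⊕ b ≡ i ⊕ (a + b)
  ⊕-assoc i a b = Fin.toℕ-injective (begin
    toℕ ((i ⊕ a) ⊕ b)                   ≡⟨ toℕ-⊕ (i ⊕ a) b ⟩
    -- Adding the multiple `q * n` keeps the residue and undoes the first reduction.
    (toℕ (i ⊕ a) + b) % n               ≡⟨ [m+kn]%n≡m%n _ q n ⟨
    (toℕ (i ⊕ a) + b + q * n) % n       ≡⟨ cong (_% n) (swap (toℕ (i ⊕ a)) b (q * n)) ⟩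
    (toℕ (i ⊕ a) + q * n + b) % n       ≡⟨ cong (λ t → (t + b) % n) (proj₂ (⊕-quotient i a)) ⟨
    (toℕ i + a + b) % n                 ≡⟨ cong (_% n) (+-assoc (toℕ i) a b) ⟩
    (toℕ i + (a + b)) % n               ≡⟨ toℕ-⊕ i (a + b) ⟨
    toℕ (i ⊕ (a + b))                   ∎)
    where
    open ≡-Reasoning
    instance _ = Fin.nonZeroIndex i
    q = proj₁ (⊕-quotient i a)
    swap : ∀ a b c → a + b + c ≡ a + c + b
    swap = ℕ-Solver.solve-∀

  ⊕-n : ∀ (i : Fin n) → i ⊕ n ≡ i
  ⊕-n i = Fin.toℕ-injective (begin
    toℕ (i ⊕ n)          ≡⟨ toℕ-⊕ i n ⟩
    (toℕ i + n) % n      ≡⟨ cong (λ t → (toℕ i + t) % n) (*-identityˡ n) ⟨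
    (toℕ i + 1 * n) % n  ≡⟨ [m+kn]%n≡m%n (toℕ i) 1 n ⟩
    toℕ i % n            ≡⟨ m<n⇒m%n≡m (Fin.toℕ<n i) ⟩
    toℕ i                ∎)
    where
    open ≡-Reasoning
    instance _ = Fin.nonZeroIndex i

  -- For even `n`, reduction modulo `n` preserves parity, so index parity can serve as a colouring.
  ⊕-parity : 2 ∣ n → ∀ (i : Fin n) m → 2 ∣ toℕ i + toℕ (i ⊕ m) → 2 ∣ m
  ⊕-parity 2∣n i m 2∣sum = ∣m+n∣m⇒∣n {2} {toℕ i + toℕ i}
    (subst (2 ∣_) eq (∣m∣n⇒∣m+n 2∣sum (∣n⇒∣m*n (proj₁ (⊕-quotient i m)) 2∣n)))
    (2∣m+m (toℕ i))
    where
    eq : toℕ i + toℕ (i ⊕ m) + proj₁ (⊕-quotient i m) * n ≡ toℕ i + toℕ i + m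
    eq = trans (+-assoc (toℕ i) _ _)
      (trans (cong (λ t → toℕ i + t) (sym (proj₂ (⊕-quotient i m)))) (sym (+-assoc (toℕ i) _ _)))

  -- Integer form of `⊕-quotient`, in which the displacements of forward and backward steps can be
  -- added up.
  ⊕-displacement : ∀ (i : Fin n) m → + n ℤ∣ (+ toℕ i ℤ.+ + m) ℤ.- + toℕ (i ⊕ m)
  ⊕-displacement i m with ⊕-quotient i m
  ... | q , eq = ℤ∣.divides (+ q) (begin
    + (toℕ i + m) ℤ.- + toℕ (i ⊕ m)                ≡⟨ cong (λ t → + t ℤ.- + toℕ (i ⊕ m)) eq ⟩
    (+ toℕ (i ⊕ m) ℤ.+ + (q * n)) ℤ.- + toℕ (i ⊕ m) ≡⟨ cancel (+ toℕ (i ⊕ m)) (+ (q * n)) ⟩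
    + (q * n)                                      ≡⟨ ℤ.pos-* q n ⟩
    + q ℤ.* + n                                    ∎)
    where
    open ≡-Reasoning
    cancel : ∀ a b → (a ℤ.+ b) ℤ.- a ≡ b
    cancel = ℤ-Solver.solve-∀

-- Walks

infixr 5 _∷_

data Walk (G : SimpleGraph) : Vertex G → Vertex G → ℕ → Set where
  []  : ∀ {x} → Walk G x x 0
  _∷_ : ∀ {x y z ℓ} → Adj G x z → Walk G z y ℓ → Walk G x y (suc ℓ)

OddClosedWalk : SimpleGraph → ℕ → Set
OddClosedWalk G ℓ = ¬ (2 ∣ ℓ) × ∃[ x ] Walk G x x ℓ

module _ {G : SimpleGraph} where

  infixr 5 _++_

  _++_ : ∀ {x y z a b} → Walk G x y a → Walk G y z b → Walk G x z (a + b)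
  []      ++ w′ = w′
  (e ∷ w) ++ w′ = e ∷ (w ++ w′)

  -- Positions past the end give the final vertex, so no bound on the position is carried along.
  at : ∀ {x y ℓ} → Walk G x y ℓ → ℕ → Vertex G
  at {x} []      _       = x
  at {x} (_ ∷ _) zero    = x
  at     (_ ∷ w) (suc i) = at w i

  at-start : ∀ {x y ℓ} (w : Walk G x y ℓ) → at w 0 ≡ x
  at-start []      = refl
  at-start (_ ∷ _) = refl

  at-end : ∀ {x y ℓ} (w : Walk G x y ℓ) → at w ℓ ≡ y
  at-end []      = refl
  at-end (_ ∷ w) = at-end w

  at-adjacent : ∀ {x y ℓ} (w : Walk G x y ℓ) i → i < ℓ → Adj G (at w i) (at w (suc i))
  at-adjacent (e ∷ w) zero    _         = subst (Adj G _) (sym (at-start w)) e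
  at-adjacent (_ ∷ w) (suc i) (s≤s i<ℓ) = at-adjacent w i i<ℓ

  segment : ∀ {x y ℓ} (w : Walk G x y ℓ) i j → i ≤ j → j ≤ ℓ → Walk G (at w i) (at w j) (j ∸ i)
  segment w       zero    zero    _         _         = []
  segment (e ∷ w) zero    (suc j) _         (s≤s j≤ℓ) =
    subst (λ t → Adj G _ t) (sym (at-start w)) e ∷ segment w 0 j z≤n j≤ℓ
  segment (_ ∷ w) (suc i) (suc j) (s≤s i≤j) (s≤s j≤ℓ) = segment w i j i≤j j≤ℓ

  -- Serves cycles and outer paths with `d = 1`, and inner paths with `d = k`.
  ⊕-walk : ∀ {n} (f : Fin n → Vertex G) d → (∀ i → Adj G (f i) (f (i ⊕ d))) →
           ∀ m i → Walk G (f i) (f (i ⊕ m * d)) m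
  ⊕-walk f d adj zero    i = subst (λ t → Walk G (f i) (f t) 0) (sym (⊕-0 i)) []
  ⊕-walk f d adj (suc m) i = adj i ∷
    subst (λ t → Walk G _ (f t) m) (⊕-assoc i d (m * d)) (⊕-walk f d adj m (i ⊕ d))

  cycle⇒closedWalk : ∀ {ℓ} → Cycle G ℓ → ∃[ x ] Walk G x x ℓ
  cycle⇒closedWalk {zero}  C = contradiction (Cycle.3≤length C) λ ()
  cycle⇒closedWalk {suc ℓ} C = Cycle.vertex C Fin.zero ,
    subst (λ t → Walk G (Cycle.vertex C Fin.zero) (Cycle.vertex C t) (suc ℓ))
      -- After `suc ℓ` unit steps the index has gone round once.
      (trans (cong (Fin.zero ⊕_) (*-identityʳ (suc ℓ))) (⊕-n Fin.zero))
      (⊕-walk (Cycle.vertex C) 1 (Cycle.adjacent C) (suc ℓ) Fin.zero)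

  odd-closedWalk-3≤ : ∀ {ℓ} → OddClosedWalk G ℓ → 3 ≤ ℓ
  odd-closedWalk-3≤ {0} (odd , _)              = contradiction (2 ∣0) odd
  odd-closedWalk-3≤ {1} (odd , x , (e ∷ []))   = contradiction e (adj-irrefl G)
  odd-closedWalk-3≤ {2} (odd , _)              = contradiction ∣-refl odd
  odd-closedWalk-3≤ {suc (suc (suc _))} _      = s≤s (s≤s (s≤s z≤n))

  -- A repeated vertex splits a closed odd walk into two closed walks, one of them odd.
  shortest⇒distinct : ∀ {g x} → ¬ 2 ∣ g → (w : Walk G x x g) →
                      (∀ ℓ → OddClosedWalk G ℓ → g ≤ ℓ) →
                      ∀ {i j} → i < j → j < g → at w i ≢ at w j
  shortest⇒distinct {g} {x} odd w shortest {i} {j} i<j j<g wi≡wj with 2 ∣? (j ∸ i)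
  ... | no  2∤j∸i = <⇒≱ (≤-<-trans (m∸n≤m j i) j<g)
          (shortest _ (2∤j∸i , at w j , subst (λ t → Walk G t (at w j) (j ∸ i)) wi≡wj loop))
    where loop = segment w i j (<⇒≤ i<j) (<⇒≤ j<g)
  ... | yes 2∣j∸i = <⇒≱ shorter (shortest _ (2∤rest , x , rest))
    where
    i≤j = <⇒≤ i<j
    j≤g = <⇒≤ j<g

    rest : Walk G x x (i + (g ∸ j))
    rest = subst₂ (λ s t → Walk G s t i) (at-start w) wi≡wj (segment w 0 i z≤n (≤-trans i≤j j≤g))
        ++ subst (λ t → Walk G (at w j) t (g ∸ j)) (at-end w) (segment w j g j≤g ≤-refl)

    total : i + (g ∸ j) + (j ∸ i) ≡ g
    total = begin
      i + (g ∸ j) + (j ∸ i)   ≡⟨ rotate i (g ∸ j) (j ∸ i) ⟩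
      (g ∸ j) + (i + (j ∸ i)) ≡⟨ cong (λ t → (g ∸ j) + t) (m+[n∸m]≡n i≤j) ⟩
      (g ∸ j) + j             ≡⟨ m∸n+n≡m j≤g ⟩
      g                       ∎
      where
      open ≡-Reasoning
      rotate : ∀ a b c → a + b + c ≡ b + (a + c)
      rotate = ℕ-Solver.solve-∀

    2∤rest : ¬ 2 ∣ i + (g ∸ j)
    2∤rest 2∣rest = odd (subst (2 ∣_) total (∣m∣n⇒∣m+n 2∣rest 2∣j∸i))

    shorter : i + (g ∸ j) < g
    shorter = subst (i + (g ∸ j) <_) total (m<m+n _ (m<n⇒0<n∸m i<j))

  -- Oddness excludes lengths below 3 and minimality excludes repeated vertices, which is all that
  -- separates a closed walk from a cycle.
  shortest⇒cycle : ∀ {g} → OddClosedWalk G g → (∀ ℓ → OddClosedWalk G ℓ → g ≤ ℓ) → Cycle G g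
  shortest⇒cycle {g} W@(odd , x , w) shortest = record
    { 3≤length = odd-closedWalk-3≤ W
    ; vertex   = at w ∘ toℕ
    ; distinct = distinct′
    ; adjacent = adjacent′
    }
    where
    distinct′ : ∀ {i j : Fin g} → at w (toℕ i) ≡ at w (toℕ j) → i ≡ j
    distinct′ {i} {j} eq with <-cmp (toℕ i) (toℕ j)
    ... | tri< i<j _ _ = contradiction eq (shortest⇒distinct odd w shortest i<j (Fin.toℕ<n j))
    ... | tri≈ _ i≡j _ = Fin.toℕ-injective i≡j
    ... | tri> _ _ j<i = contradiction (sym eq) (shortest⇒distinct odd w shortest j<i (Fin.toℕ<n i))

    next : ∀ (i : Fin g) → at w (suc (toℕ i)) ≡ at w (toℕ (i ⊕ 1))
    next i with m≤n⇒m<n∨m≡n (Fin.toℕ<n i)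
    ... | inj₁ 1+i<g = cong (at w) (sym (trans (toℕ-⊕ i 1)
          (trans (cong (_% g) (+-comm (toℕ i) 1)) (m<n⇒m%n≡m 1+i<g))))
      where instance _ = Fin.nonZeroIndex i
    -- At the last index `i ⊕ 1` wraps to 0, and the walk ends where it starts.
    ... | inj₂ 1+i≡g = begin
      at w (suc (toℕ i))  ≡⟨ cong (at w) 1+i≡g ⟩
      at w g              ≡⟨ at-end w ⟩
      x                   ≡⟨ at-start w ⟨
      at w 0              ≡⟨ cong (at w) (sym wraps) ⟩
      at w (toℕ (i ⊕ 1))  ∎
      where
      open ≡-Reasoning
      instance _ = Fin.nonZeroIndex i
      wraps : toℕ (i ⊕ 1) ≡ 0
      wraps = trans (toℕ-⊕ i 1) (trans (cong (_% g) (trans (+-comm (toℕ i) 1) 1+i≡g)) (n%n≡0 g))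

    adjacent′ : ∀ i → Adj G (at w (toℕ i)) (at w (toℕ (i ⊕ 1)))
    adjacent′ i = subst (Adj G _) (next i) (at-adjacent w (toℕ i) (Fin.toℕ<n i))

  -- Existence of the odd girth by exhaustive search

  module _ (search : ∀ {P : Vertex G → Set} → Decidable P → Dec (∃ P))
           (_≟ᵥ_ : DecidableEquality (Vertex G))
           (adj? : ∀ x y → Dec (Adj G x y)) where

    walk? : ∀ x y ℓ → Dec (Walk G x y ℓ)
    walk? x y zero    = map′ (λ { refl → [] }) (λ { [] → refl }) (x ≟ᵥ y)
    walk? x y (suc ℓ) = map′ (λ { (_ , e , w) → e ∷ w }) (λ { (e ∷ w) → _ , e , w })
      (search (λ z → adj? x z ×-dec walk? z y ℓ))

    -- Minimising over closed walks suffices: a shortest odd one is a cycle, and every cycle is a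
    -- closed walk. The walk data is returned too, so that bounds can be proved for walks.
    oddGirth-exists : ∀ {ℓ} → OddClosedWalk G ℓ →
      ∃[ g ] IsOddGirth G g × OddClosedWalk G g × (∀ ℓ → OddClosedWalk G ℓ → g ≤ ℓ)
    oddGirth-exists {ℓ} W
      with least (λ m → ¬? (2 ∣? m) ×-dec search (λ x → walk? x x m)) ℓ W
    ... | g , Wg , shortest = g ,
      ((proj₁ Wg , shortest⇒cycle Wg shortest) ,
       (λ m (odd , C) → shortest m (odd , cycle⇒closedWalk C))) , Wg , shortest

-- Signed displacement of a walk in Pet(n,k)

index : ∀ {n} → PetVertex n → ℕ
index (u i) = toℕ i
index (v i) = toℕ i

layer : ∀ {n} → PetVertex n → ℕ
layer (u _) = 0
layer (v _) = 1

-- The displacement that stays 0 as long as the walk has not left the layer of x.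
crossLayer : ∀ {n} → PetVertex n → ℤ → ℤ → ℤ
crossLayer (u _) X Y = Y
crossLayer (v _) X Y = X

-- A step away from 0 raises the absolute value by 1, with `c = 0`; a step towards 0 lowers it by 1,
-- so it falls 2 behind the length, with `c = 1`.
suc-∣∣ : ∀ X → ∃[ c ] suc ℤ.∣ X ∣ ≡ ℤ.∣ 1ℤ ℤ.+ X ∣ + 2 * c
suc-∣∣ (+ m)          = 0 , sym (+-identityʳ (suc m))
suc-∣∣ -[1+ zero ]    = 1 , refl
suc-∣∣ -[1+ (suc m) ] = 1 , cong suc (+-comm 2 m)

pred-∣∣ : ∀ X → ∃[ c ] suc ℤ.∣ X ∣ ≡ ℤ.∣ -1ℤ ℤ.+ X ∣ + 2 * c
pred-∣∣ (+ zero)  = 0 , refl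
pred-∣∣ (+ suc m) = 1 , +-comm 2 m
pred-∣∣ -[1+ m ]  = 0 , cong (λ t → suc (suc t)) (sym (+-identityʳ m))

outer-length : ∀ {X′ ℓ} X Y s c → ∃[ c₁ ] suc ℤ.∣ X ∣ ≡ ℤ.∣ X′ ∣ + 2 * c₁ →
  ℓ ≡ ℤ.∣ X ∣ + Y + s + 2 * c → ∃[ c′ ] suc ℓ ≡ ℤ.∣ X′ ∣ + Y + s + 2 * c′
outer-length {X′} X Y s c (c₁ , eq) refl = c₁ + c ,
  trans (cong (λ t → t + Y + s + 2 * c) eq) (regroup ℤ.∣ X′ ∣ Y s c c₁)
  where
  regroup : ∀ x y s c c₁ → x + 2 * c₁ + y + s + 2 * c ≡ x + y + s + 2 * (c₁ + c)
  regroup = ℕ-Solver.solve-∀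

inner-length : ∀ {Y′ ℓ} X Y s c → ∃[ c₁ ] suc ℤ.∣ Y ∣ ≡ ℤ.∣ Y′ ∣ + 2 * c₁ →
  ℓ ≡ X + ℤ.∣ Y ∣ + s + 2 * c → ∃[ c′ ] suc ℓ ≡ X + ℤ.∣ Y′ ∣ + s + 2 * c′
inner-length {Y′} X Y s c c₁ eq
  with outer-length {Y′} Y X s c c₁ (trans eq (cong (λ t → t + s + 2 * c) (+-comm X ℤ.∣ Y ∣)))
... | c′ , eq′ = c′ , trans eq′ (cong (λ t → t + s + 2 * c′) (+-comm ℤ.∣ Y′ ∣ X))

spoke-length : ∀ {ℓ} a s c → ℓ ≡ a + s + 2 * c → suc ℓ ≡ a + suc s + 2 * c
spoke-length a s c refl = cong (λ t → t + 2 * c) (sym (+-suc a s))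

module _ {n k : ℕ} (2<2k : 2 < 2 * k) (2k≤n : 2 * k ≤ n) where

  private
    P = Pet n k 2<2k 2k≤n

  -- X and Y are the net numbers of outer and inner steps, and 2c counts the steps lost to
  -- cancellation in them.
  record Trace (x y : PetVertex n) (ℓ : ℕ) : Set where
    field
      X Y          : ℤ
      spokes c     : ℕ
      length≡      : ℓ ≡ ℤ.∣ X ∣ + ℤ.∣ Y ∣ + spokes + 2 * c
      displacement : + n ℤ∣ (+ index x ℤ.+ X ℤ.+ + k ℤ.* Y) ℤ.- + index y
      layers       : 2 ∣ layer x + spokes + layer y
      unspoked     : spokes ≡ 0 → crossLayer x X Y ≡ 0ℤ

  private
    combine : ∀ {D E F} → D ℤ.+ E ≡ F → + n ℤ∣ D → + n ℤ∣ E → + n ℤ∣ F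
    combine eq n∣D n∣E = subst (+ n ℤ∣_) eq (ℤ∣.∣m∣n⇒∣m+n n∣D n∣E)

    -- In these identities `j` stands for the reduced endpoint of the first edge. The displacement
    -- of the remaining walk is corrected by that of the edge, negated for a backward edge. In the
    -- outer ones `K` is `k * Y`, in the inner ones `k`.
    outer-fwd : ∀ i j X K z → (j ℤ.+ X ℤ.+ K ℤ.- z) ℤ.+ ((i ℤ.+ 1ℤ) ℤ.- j)
                            ≡ i ℤ.+ (1ℤ ℤ.+ X) ℤ.+ K ℤ.- z
    outer-fwd = ℤ-Solver.solve-∀

    outer-bwd : ∀ i j X K z → (i ℤ.+ X ℤ.+ K ℤ.- z) ℤ.+ ℤ.- ((i ℤ.+ 1ℤ) ℤ.- j)
                            ≡ j ℤ.+ (-1ℤ ℤ.+ X) ℤ.+ K ℤ.- z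
    outer-bwd = ℤ-Solver.solve-∀

    inner-fwd : ∀ i j X K Y z → (j ℤ.+ X ℤ.+ K ℤ.* Y ℤ.- z) ℤ.+ ((i ℤ.+ K) ℤ.- j)
                              ≡ i ℤ.+ X ℤ.+ K ℤ.* (1ℤ ℤ.+ Y) ℤ.- z
    inner-fwd = ℤ-Solver.solve-∀

    inner-bwd : ∀ i j X K Y z → (i ℤ.+ X ℤ.+ K ℤ.* Y ℤ.- z) ℤ.+ ℤ.- ((i ℤ.+ K) ℤ.- j)
                              ≡ j ℤ.+ X ℤ.+ K ℤ.* (-1ℤ ℤ.+ Y) ℤ.- z
    inner-bwd = ℤ-Solver.solve-∀

  trace-∷ : ∀ {x y z ℓ} → Adj P x z → Trace z y ℓ → Trace x y (suc ℓ)
  trace-∷ {y = y} (fwd (outer i)) T = record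
    { X = 1ℤ ℤ.+ X ; Y = Y ; spokes = spokes ; c = proj₁ len ; length≡ = proj₂ len
    ; displacement = combine (outer-fwd (+ toℕ i) (+ toℕ (i ⊕ 1)) X (+ k ℤ.* Y) (+ index y))
        displacement (⊕-displacement i 1)
    -- An outer step stays among the `u` vertices, where `crossLayer` is `Y`, and leaves `Y` alone.
    ; layers = layers ; unspoked = unspoked }
    where
    open Trace T
    len = outer-length {1ℤ ℤ.+ X} X ℤ.∣ Y ∣ spokes c (suc-∣∣ X) length≡
  trace-∷ {y = y} (bwd (outer i)) T = record
    { X = -1ℤ ℤ.+ X ; Y = Y ; spokes = spokes ; c = proj₁ len ; length≡ = proj₂ len
    ; displacement = combine (outer-bwd (+ toℕ i) (+ toℕ (i ⊕ 1)) X (+ k ℤ.* Y) (+ index y))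
        displacement (ℤ∣.∣m⇒∣-m (⊕-displacement i 1))
    ; layers = layers ; unspoked = unspoked }
    where
    open Trace T
    len = outer-length { -1ℤ ℤ.+ X} X ℤ.∣ Y ∣ spokes c (pred-∣∣ X) length≡
  trace-∷ {y = y} (fwd (inner i)) T = record
    { X = X ; Y = 1ℤ ℤ.+ Y ; spokes = spokes ; c = proj₁ len ; length≡ = proj₂ len
    ; displacement = combine (inner-fwd (+ toℕ i) (+ toℕ (i ⊕ k)) X (+ k) Y (+ index y))
        displacement (⊕-displacement i k)
    ; layers = layers ; unspoked = unspoked }
    where
    open Trace T
    len = inner-length {1ℤ ℤ.+ Y} ℤ.∣ X ∣ Y spokes c (suc-∣∣ Y) length≡
  trace-∷ {y = y} (bwd (inner i)) T = record
    { X = X ; Y = -1ℤ ℤ.+ Y ; spokes = spokes ; c = proj₁ len ; length≡ = proj₂ len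
    ; displacement = combine (inner-bwd (+ toℕ i) (+ toℕ (i ⊕ k)) X (+ k) Y (+ index y))
        displacement (ℤ∣.∣m⇒∣-m (⊕-displacement i k))
    ; layers = layers ; unspoked = unspoked }
    where
    open Trace T
    len = inner-length { -1ℤ ℤ.+ Y} ℤ.∣ X ∣ Y spokes c (pred-∣∣ Y) length≡
  trace-∷ (fwd (spoke i)) T = record
    { X = X ; Y = Y ; spokes = suc spokes ; c = c
    ; length≡ = spoke-length (ℤ.∣ X ∣ + ℤ.∣ Y ∣) spokes c length≡
    -- The 1 from the layer of `v i` becomes the 1 of the new spoke, so the sum in `layers` is the
    -- same by computation.
    ; displacement = displacement ; layers = layers ; unspoked = λ () }
    where open Trace T
  trace-∷ (bwd (spoke i)) T = record
    { X = X ; Y = Y ; spokes = suc spokes ; c = c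
    ; length≡ = spoke-length (ℤ.∣ X ∣ + ℤ.∣ Y ∣) spokes c length≡
    ; displacement = displacement ; layers = ∣m∣n⇒∣m+n ∣-refl layers ; unspoked = λ () }
    where open Trace T

  trace : ∀ {x y ℓ} → Walk P x y ℓ → Trace x y ℓ
  trace {x} [] = record
    { X = 0ℤ ; Y = 0ℤ ; spokes = 0 ; c = 0 ; length≡ = refl
    ; displacement = ℤ∣.divides 0ℤ (cancel (+ index x) (+ k))
    ; layers = subst (λ t → 2 ∣ t + layer x) (sym (+-identityʳ (layer x))) (2∣m+m (layer x))
    ; unspoked = λ _ → still x }
    where
    cancel : ∀ a b → (a ℤ.+ 0ℤ ℤ.+ b ℤ.* 0ℤ) ℤ.- a ≡ 0ℤ
    cancel = ℤ-Solver.solve-∀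
    still : ∀ x → crossLayer x 0ℤ 0ℤ ≡ 0ℤ
    still (u _) = refl
    still (v _) = refl
  trace (e ∷ w) = trace-∷ e (trace w)

-- Arithmetic of closed odd walks

-- The difference is 0 or twice the absolute value; hence absolute values preserve parity.
2∣∣X∣-X : ∀ X → + 2 ℤ∣ + ℤ.∣ X ∣ ℤ.- X
2∣∣X∣-X (+ m)    = ℤ∣.divides 0ℤ (ℤ.+-inverseʳ (+ m))
2∣∣X∣-X -[1+ m ] = ℤ∣.∣ᵤ⇒∣ (2∣m+m (suc m))

∣∣-sum-even : ∀ X Y → + 2 ℤ∣ X ℤ.+ Y → 2 ∣ ℤ.∣ X ∣ + ℤ.∣ Y ∣
∣∣-sum-even X Y 2∣X+Y = ℤ∣.∣⇒∣ᵤ (subst (+ 2 ℤ∣_) (regroup (+ ℤ.∣ X ∣) (+ ℤ.∣ Y ∣) X Y)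
  (ℤ∣.∣m∣n⇒∣m+n 2∣X+Y (ℤ∣.∣m∣n⇒∣m+n (2∣∣X∣-X X) (2∣∣X∣-X Y))))
  where
  regroup : ∀ a b X Y → (X ℤ.+ Y) ℤ.+ ((a ℤ.- X) ℤ.+ (b ℤ.- Y)) ≡ a ℤ.+ b
  regroup = ℤ-Solver.solve-∀

-- Oddness excludes `m = 0`, where divisibility gives no bound.
odd-∣⇒≤ : ∀ {d m} → ¬ 2 ∣ m → d ∣ m → d ≤ m
odd-∣⇒≤ {m = zero}  2∤m _   = contradiction (2 ∣0) 2∤m
odd-∣⇒≤ {m = suc _} _   d∣m = ∣⇒≤ d∣m

odd-∣2⇒≡1 : ∀ {d} → ¬ 2 ∣ d → d ∣ 2 → d ≡ 1
odd-∣2⇒≡1 {0}                 2∤d d∣2 = contradiction (2 ∣0) 2∤d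
odd-∣2⇒≡1 {1}                 2∤d d∣2 = refl
odd-∣2⇒≡1 {2}                 2∤d d∣2 = contradiction ∣-refl 2∤d
odd-∣2⇒≡1 {suc (suc (suc d))} 2∤d d∣2 = contradiction d∣2 (>⇒∤ (s≤s (s≤s (s≤s z≤n))))

-- Distinct odd numbers differ by at least 2, and equal divisors of a and a + 2 divide 2.
odd-divisors-bound : ∀ {a d e ℓ} → ¬ 2 ∣ d → ¬ 2 ∣ e → d ∣ a → e ∣ a + 2 →
                     d ≤ ℓ → e ≤ ℓ → 3 ≤ ℓ → d ⊓ e + 2 ≤ ℓ
odd-divisors-bound {a} {d} {e} {ℓ} 2∤d 2∤e d∣a e∣a+2 d≤ℓ e≤ℓ 3≤ℓ with <-cmp d e
... | tri< d<e _ _ = ≤-trans (+-monoˡ-≤ 2 (m⊓n≤m d e)) (≤-trans (odd<odd⇒2+≤ 2∤d 2∤e d<e) e≤ℓ)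
... | tri> _ _ e<d = ≤-trans (+-monoˡ-≤ 2 (m⊓n≤n d e)) (≤-trans (odd<odd⇒2+≤ 2∤e 2∤d e<d) d≤ℓ)
... | tri≈ _ refl _ = ≤-trans (+-monoˡ-≤ 2 (m⊓n≤m d d))
        (subst (λ t → t + 2 ≤ ℓ) (sym (odd-∣2⇒≡1 2∤d (∣m+n∣m⇒∣n e∣a+2 d∣a))) 3≤ℓ)

-- Lower bounds for the length of an odd closed walk

module _ {n k : ℕ} (2<2k : 2 < 2 * k) (2k≤n : 2 * k ≤ n) where

  private
    P = Pet n k 2<2k 2k≤n

    1<k : 1 < k
    1<k = *-cancelˡ-< 2 1 k 2<2k

    k≡1+[k∸1] : k ≡ suc (k ∸ 1)
    k≡1+[k∸1] = sym (m+[n∸m]≡n (<⇒≤ 1<k))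

    k-odd⇒2∣k∸1 : ¬ 2 ∣ k → 2 ∣ k ∸ 1
    k-odd⇒2∣k∸1 2∤k =
      ∣m+n∣m⇒∣n {2} {2} (subst (2 ∣_) (cong suc k≡1+[k∸1]) (odd⇒even-suc 2∤k)) ∣-refl

    k+1≡[k∸1]+2 : k + 1 ≡ k ∸ 1 + 2
    k+1≡[k∸1]+2 = trans (cong (λ t → t + 1) k≡1+[k∸1]) (sym (+-suc (k ∸ 1) 1))

  module _ {ℓ} (odd : ¬ 2 ∣ ℓ) {x} (w : Walk P x x ℓ) where

    private
      open Trace (trace 2<2k 2k≤n w)

      -- A closed walk ends in its starting layer, which is therefore counted twice in `layers`.
      2∣spokes : 2 ∣ spokes
      2∣spokes = ∣m+n∣m⇒∣n {2} {layer x + layer x}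
        (subst (2 ∣_) (swap (layer x) spokes) layers) (2∣m+m (layer x))
        where
        swap : ∀ l s → l + s + l ≡ l + l + s
        swap = ℕ-Solver.solve-∀

      D : ℤ
      D = X ℤ.+ + k ℤ.* Y

      n∣D : + n ℤ∣ D
      n∣D = subst (+ n ℤ∣_) (cancel (+ index x) X (+ k ℤ.* Y)) displacement
        where
        cancel : ∀ a b c → (a ℤ.+ b ℤ.+ c) ℤ.- a ≡ b ℤ.+ c
        cancel = ℤ-Solver.solve-∀

      -- `spokes` and `2 * c` are even, so `X + Y` has the parity of the length.
      sum-odd : ¬ (+ 2 ℤ∣ X ℤ.+ Y)
      sum-odd 2∣X+Y = odd (subst (2 ∣_) (sym length≡)
        (∣m∣n⇒∣m+n (∣m∣n⇒∣m+n (∣∣-sum-even X Y 2∣X+Y) 2∣spokes) (m∣m*n c)))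

      difference-odd : ¬ (+ 2 ℤ∣ X ℤ.- Y)
      difference-odd 2∣X-Y = sum-odd (subst (+ 2 ℤ∣_) (shift X Y)
        (ℤ∣.∣m∣n⇒∣m+n 2∣X-Y (ℤ∣.∣m⇒∣m*n Y (ℤ∣.∣-refl {+ 2}))))
        where
        shift : ∀ X Y → (X ℤ.- Y) ℤ.+ + 2 ℤ.* Y ≡ X ℤ.+ Y
        shift = ℤ-Solver.solve-∀

      -- Modulo a divisor of `k ∸ 1` the factor `k` acts as 1, so `D` is congruent to `X + Y`;
      -- modulo a divisor of `k + 1` it acts as -1, which gives `X - Y` below.
      D-sum : D ≡ X ℤ.+ Y ℤ.+ + (k ∸ 1) ℤ.* Y
      D-sum = trans (cong (λ t → X ℤ.+ + t ℤ.* Y) k≡1+[k∸1]) (regroup X Y (+ (k ∸ 1)))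
        where
        regroup : ∀ X Y J → X ℤ.+ (1ℤ ℤ.+ J) ℤ.* Y ≡ X ℤ.+ Y ℤ.+ J ℤ.* Y
        regroup = ℤ-Solver.solve-∀

      D-difference : D ≡ X ℤ.- Y ℤ.+ + (k + 1) ℤ.* Y
      D-difference = regroup X Y (+ k)
        where
        regroup : ∀ X Y K → X ℤ.+ K ℤ.* Y ≡ X ℤ.- Y ℤ.+ (K ℤ.+ 1ℤ) ℤ.* Y
        regroup = ℤ-Solver.solve-∀

      ∣D⇒∣sum : ∀ {d} → d ∣ k ∸ 1 → + d ℤ∣ D → + d ℤ∣ X ℤ.+ Y
      ∣D⇒∣sum d∣k-1 d∣D =
        ℤ∣.∣m+n∣n⇒∣m (subst (_ ℤ∣_) D-sum d∣D) (ℤ∣.∣m⇒∣m*n {m = + (k ∸ 1)} Y (ℤ∣.∣ᵤ⇒∣ d∣k-1))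

      ∣D⇒∣difference : ∀ {d} → d ∣ k + 1 → + d ℤ∣ D → + d ℤ∣ X ℤ.- Y
      ∣D⇒∣difference d∣k+1 d∣D =
        ℤ∣.∣m+n∣n⇒∣m (subst (_ ℤ∣_) D-difference d∣D) (ℤ∣.∣m⇒∣m*n {m = + (k + 1)} Y (ℤ∣.∣ᵤ⇒∣ d∣k+1))

      steps≤ℓ : ℤ.∣ X ∣ + ℤ.∣ Y ∣ + spokes ≤ ℓ
      steps≤ℓ = subst (ℤ.∣ X ∣ + ℤ.∣ Y ∣ + spokes ≤_) (sym length≡) (m≤m+n _ (2 * c))

      ∣X∣+∣Y∣≤ℓ : ℤ.∣ X ∣ + ℤ.∣ Y ∣ ≤ ℓ
      ∣X∣+∣Y∣≤ℓ = ≤-trans (m≤m+n _ spokes) steps≤ℓ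

      odd-divisor-bound : ∀ {d Z} → ¬ (+ 2 ℤ∣ Z) → + d ℤ∣ Z → ℤ.∣ Z ∣ ≤ ℤ.∣ X ∣ + ℤ.∣ Y ∣ →
                          (¬ 2 ∣ d) × d ≤ ℓ
      odd-divisor-bound 2∤Z d∣Z Z≤ =
        (λ 2∣d → 2∤Z (ℤ∣.∣ᵤ⇒∣ (∣-trans 2∣d (ℤ∣.∣⇒∣ᵤ d∣Z)))) ,
        ≤-trans (odd-∣⇒≤ (2∤Z ∘ ℤ∣.∣ᵤ⇒∣) (ℤ∣.∣⇒∣ᵤ d∣Z)) (≤-trans Z≤ ∣X∣+∣Y∣≤ℓ)

      ∣n⇒∣D : ∀ {d} → d ∣ n → + d ℤ∣ D
      ∣n⇒∣D d∣n = ℤ∣.∣-trans (ℤ∣.∣ᵤ⇒∣ d∣n) n∣D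

    gcd-bound : gcd n (k ∸ 1) ⊓ gcd n (k + 1) + 2 ≤ ℓ
    -- The two gcds divide `k ∸ 1` and `k ∸ 1 + 2`, so `k ∸ 1` is the `a` of the divisor bound.
    gcd-bound = odd-divisors-bound (proj₁ d₁) (proj₁ d₂) (gcd[m,n]∣n n (k ∸ 1))
      (subst (gcd n (k + 1) ∣_) k+1≡[k∸1]+2 (gcd[m,n]∣n n (k + 1)))
      (proj₂ d₁) (proj₂ d₂) (odd-closedWalk-3≤ (odd , x , w))
      where
      d₁ = odd-divisor-bound sum-odd
        (∣D⇒∣sum (gcd[m,n]∣n n (k ∸ 1)) (∣n⇒∣D (gcd[m,n]∣m n (k ∸ 1)))) (ℤ.∣i+j∣≤∣i∣+∣j∣ X Y)
      d₂ = odd-divisor-bound difference-odd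
        (∣D⇒∣difference (gcd[m,n]∣n n (k + 1)) (∣n⇒∣D (gcd[m,n]∣m n (k + 1)))) (ℤ.∣i-j∣≤∣i∣+∣j∣ X Y)

    private
      -- A nonzero multiple of `n` has absolute value at least `n`, while each step contributes at
      -- most `k`.
      D≢0⇒n≤ℓk : ℤ.∣ D ∣ ≢ 0 → n ≤ ℓ * k
      D≢0⇒n≤ℓk D≢0 = begin
        n                              ≤⟨ ∣⇒≤ {{≢-nonZero D≢0}} (ℤ∣.∣⇒∣ᵤ n∣D) ⟩
        ℤ.∣ D ∣                        ≤⟨ ℤ.∣i+j∣≤∣i∣+∣j∣ X (+ k ℤ.* Y) ⟩
        ℤ.∣ X ∣ + ℤ.∣ + k ℤ.* Y ∣       ≡⟨ cong (λ t → ℤ.∣ X ∣ + t) (ℤ.abs-* (+ k) Y) ⟩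
        ℤ.∣ X ∣ + k * ℤ.∣ Y ∣           ≤⟨ +-monoˡ-≤ _ (m≤n*m ℤ.∣ X ∣ k {{>-nonZero (<⇒≤ 1<k)}}) ⟩
        k * ℤ.∣ X ∣ + k * ℤ.∣ Y ∣       ≡⟨ *-distribˡ-+ k ℤ.∣ X ∣ ℤ.∣ Y ∣ ⟨
        k * (ℤ.∣ X ∣ + ℤ.∣ Y ∣)         ≤⟨ *-monoʳ-≤ k ∣X∣+∣Y∣≤ℓ ⟩
        k * ℓ                          ≡⟨ *-comm k ℓ ⟩
        ℓ * k                          ∎
        where open ≤-Reasoning

      module _ (D≡0 : D ≡ 0ℤ) where

        2∣k : 2 ∣ k
        2∣k with 2 ∣? k
        ... | yes 2∣k = 2∣k
        -- For odd `k`, 2 divides `k ∸ 1`, so `D ≡ 0ℤ` would make `X + Y` even.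
        ... | no  2∤k = contradiction
          (∣D⇒∣sum (k-odd⇒2∣k∸1 2∤k) (subst (+ 2 ℤ∣_) (sym D≡0) (ℤ∣.∣ᵤ⇒∣ (2 ∣0)))) sum-odd

        ∣X∣≡k∣Y∣ : ℤ.∣ X ∣ ≡ k * ℤ.∣ Y ∣
        ∣X∣≡k∣Y∣ = begin
          ℤ.∣ X ∣                       ≡⟨ cong ℤ.∣_∣ (isolate X (+ k ℤ.* Y)) ⟩
          ℤ.∣ D ℤ.- + k ℤ.* Y ∣         ≡⟨ cong (λ t → ℤ.∣ t ℤ.- + k ℤ.* Y ∣) D≡0 ⟩
          ℤ.∣ 0ℤ ℤ.- + k ℤ.* Y ∣        ≡⟨ cong ℤ.∣_∣ (ℤ.+-identityˡ (ℤ.- (+ k ℤ.* Y))) ⟩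
          ℤ.∣ ℤ.- (+ k ℤ.* Y) ∣         ≡⟨ ℤ.∣-i∣≡∣i∣ (+ k ℤ.* Y) ⟩
          ℤ.∣ + k ℤ.* Y ∣               ≡⟨ ℤ.abs-* (+ k) Y ⟩
          k * ℤ.∣ Y ∣                   ∎
          where
          open ≡-Reasoning
          isolate : ∀ a b → a ≡ (a ℤ.+ b) ℤ.- b
          isolate = ℤ-Solver.solve-∀

        -- If `Y` vanished, so would `X`, and their sum would be even.
        Y≢0 : Y ≢ 0ℤ
        Y≢0 Y≡0 = sum-odd (subst₂ (λ a b → + 2 ℤ∣ a ℤ.+ b) (sym X≡0) (sym Y≡0) (ℤ∣.∣ᵤ⇒∣ (2 ∣0)))
          where
          X≡0 : X ≡ 0ℤ
          X≡0 = ℤ.∣i∣≡0⇒i≡0 (trans ∣X∣≡k∣Y∣ (trans (cong (λ t → k * ℤ.∣ t ∣) Y≡0) (*-zeroʳ k)))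

        0<∣Y∣ : 0 < ℤ.∣ Y ∣
        0<∣Y∣ = n≢0⇒n>0 (Y≢0 ∘ ℤ.∣i∣≡0⇒i≡0)

        k≤∣X∣ : k ≤ ℤ.∣ X ∣
        k≤∣X∣ = subst (k ≤_) (sym ∣X∣≡k∣Y∣) (m≤m*n k ℤ.∣ Y ∣ {{>-nonZero 0<∣Y∣}})

        X≢0 : X ≢ 0ℤ
        X≢0 X≡0 = <⇒≱ (<⇒≤ 1<k) (subst (λ t → k ≤ ℤ.∣ t ∣) X≡0 k≤∣X∣)

        crossLayer≢0 : ∀ y → crossLayer {n} y X Y ≢ 0ℤ
        crossLayer≢0 (u _) = Y≢0
        crossLayer≢0 (v _) = X≢0

        -- With `X` and `Y` both nonzero the walk must leave its starting layer, so the even number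
        -- of spokes is positive.
        2≤spokes : 2 ≤ spokes
        2≤spokes = ∣⇒≤ {{≢-nonZero (crossLayer≢0 x ∘ unspoked)}} 2∣spokes

        D≡0⇒k+3≤ℓ : k + 3 ≤ ℓ
        D≡0⇒k+3≤ℓ = begin
          k + 3                         ≡⟨ +-assoc k 1 2 ⟨
          k + 1 + 2                     ≤⟨ +-mono-≤ (+-mono-≤ k≤∣X∣ 0<∣Y∣) 2≤spokes ⟩
          ℤ.∣ X ∣ + ℤ.∣ Y ∣ + spokes     ≤⟨ steps≤ℓ ⟩
          ℓ                             ∎
          where open ≤-Reasoning

    -- The second alternative keeps `2 ∣ k`, so it is refuted either by odd `k` or by a length below
    -- `k + 3`.
    winding-bound : n ≤ ℓ * k ⊎ 2 ∣ k × k + 3 ≤ ℓ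
    winding-bound with D ℤ.≟ 0ℤ
    ... | yes D≡0 = inj₂ (2∣k D≡0 , D≡0⇒k+3≤ℓ D≡0)
    ... | no  D≢0 = inj₁ (D≢0⇒n≤ℓk (D≢0 ∘ ℤ.∣i∣≡0⇒i≡0))

  -- Explicit walks

  private
    outer-walk : ∀ m (i : Fin n) → Walk P (u i) (u (i ⊕ m)) m
    outer-walk m i = subst (λ t → Walk P (u i) (u (i ⊕ t)) m) (*-identityʳ m)
      (⊕-walk u 1 (fwd ∘ outer) m i)

    inner-walk : ∀ m (i : Fin n) → Walk P (v i) (v (i ⊕ m * k)) m
    inner-walk = ⊕-walk v k (fwd ∘ inner)

    0<n : 0 < n
    0<n = ≤-trans (<⇒≤ (<⇒≤ 2<2k)) 2k≤n

    origin : Fin n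
    origin = Fin.fromℕ< 0<n

  k-even⇒oddClosedWalk : 2 ∣ k → OddClosedWalk P (k + 3)
  k-even⇒oddClosedWalk 2∣k =
    (λ 2∣k+3 → odd⇒suc-odd ∣-refl (∣m+n∣m⇒∣n 2∣k+3 2∣k)) ,
    u origin ,
    -- One inner step, taken backward between two spokes, undoes the `k` outer steps.
    outer-walk k origin ++ fwd (spoke (origin ⊕ k)) ∷ bwd (inner origin) ∷ bwd (spoke origin) ∷ []

  k-odd⇒oddClosedWalk : .{{_ : NonZero k}} → ¬ 2 ∣ k → ¬ 2 ∣ n →
                        OddClosedWalk P (n /ℕ k + (1 + (n % k + 1)))
  k-odd⇒oddClosedWalk 2∤k 2∤n = odd , v origin ,
    -- The inner steps advance by `q * k` and the outer ones by `r`, together exactly `n`.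
    inner-walk q origin ++ bwd (spoke (origin ⊕ q * k))
      ∷ subst (λ t → Walk P (u (origin ⊕ q * k)) (u t) r) returns (outer-walk r (origin ⊕ q * k))
      ++ fwd (spoke origin) ∷ []
    where
    q = n /ℕ k
    r = n % k

    returns : (origin ⊕ q * k) ⊕ r ≡ origin
    returns = begin
      (origin ⊕ q * k) ⊕ r  ≡⟨ ⊕-assoc origin (q * k) r ⟩
      origin ⊕ (q * k + r)  ≡⟨ cong (origin ⊕_) (trans (+-comm (q * k) r) (sym (m≡m%n+[m/n]*n n k))) ⟩
      origin ⊕ n            ≡⟨ ⊕-n origin ⟩
      origin                ∎
      where open ≡-Reasoning

    odd : ¬ 2 ∣ q + (1 + (r + 1))
    odd 2∣len = 2∤n (∣m+n∣m⇒∣n {2} {2}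
      (subst (2 ∣_) (begin
        -- Since `k ∸ 1` is even, adding `q * (k ∸ 1)` keeps the parity and turns the length into
        -- `2 + n`.
        q + (1 + (r + 1)) + q * (k ∸ 1)  ≡⟨ regroup q r (k ∸ 1) ⟩
        2 + (r + q * suc (k ∸ 1))        ≡⟨ cong (λ t → 2 + (r + q * t)) k≡1+[k∸1] ⟨
        2 + (r + q * k)                  ≡⟨ cong (λ t → 2 + t) (m≡m%n+[m/n]*n n k) ⟨
        2 + n                            ∎)
        (∣m∣n⇒∣m+n 2∣len (∣n⇒∣m*n q (k-odd⇒2∣k∸1 2∤k))))
      ∣-refl)
      where
      open ≡-Reasoning
      regroup : ∀ q r j → q + (1 + (r + 1)) + q * j ≡ 2 + (r + q * suc j)
      regroup = ℕ-Solver.solve-∀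

  -- The bipartite case

  bipartite : 2 ∣ n → ¬ 2 ∣ k → Bipartite P
  bipartite 2∣n 2∤k = (λ x → does (2 ∣? weight x)) , proper
    where
    weight : PetVertex n → ℕ
    weight (u i) = toℕ i
    -- The shift by one makes spokes change colour; the steps 1 and `k` do so because they are odd
    -- and `n` is even.
    weight (v i) = suc (toℕ i)

    edge-odd : ∀ {x y} → PetEdge n k x y → ¬ 2 ∣ weight x + weight y
    edge-odd (outer i) 2∣ = odd⇒suc-odd (2 ∣0) (⊕-parity 2∣n i 1 2∣)
    edge-odd (spoke i) 2∣ = odd⇒suc-odd (2∣m+m (toℕ i)) (subst (2 ∣_) (+-suc (toℕ i) (toℕ i)) 2∣)
    edge-odd (inner i) 2∣ = 2∤k (⊕-parity 2∣n i k (∣m+n∣m⇒∣n {2} {2}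
      (subst (2 ∣_) (cong suc (+-suc (toℕ i) _)) 2∣) ∣-refl))

    same-colour : ∀ {a b} (a? : Dec (2 ∣ a)) (b? : Dec (2 ∣ b)) → does a? ≡ does b? → 2 ∣ a + b
    same-colour (yes 2∣a) (yes 2∣b) _ = ∣m∣n⇒∣m+n 2∣a 2∣b
    same-colour (no  2∤a) (no  2∤b) _ = odd+odd 2∤a 2∤b

    proper : ∀ x y → Adj P x y → does (2 ∣? weight x) ≢ does (2 ∣? weight y)
    proper x y (fwd e) eq = edge-odd e (same-colour (2 ∣? weight x) (2 ∣? weight y) eq)
    proper x y (bwd e) eq = edge-odd e (same-colour (2 ∣? weight y) (2 ∣? weight x) (sym eq))

  -- Decidability of adjacency and finite search over the vertices

  private
    search : ∀ {Q : PetVertex n → Set} → Decidable Q → Dec (∃ Q)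
    search Q? = map′
      [ (λ (i , q) → u i , q) , (λ (i , q) → v i , q) ]′
      (λ { (u i , q) → inj₁ (i , q) ; (v i , q) → inj₂ (i , q) })
      (Fin.any? (Q? ∘ u) ⊎-dec Fin.any? (Q? ∘ v))

    _≟ᵥ_ : DecidableEquality (PetVertex n)
    u i ≟ᵥ u j = map′ (cong u) u-injective (i Fin.≟ j)
    v i ≟ᵥ v j = map′ (cong v) v-injective (i Fin.≟ j)
    u _ ≟ᵥ v _ = no λ ()
    v _ ≟ᵥ u _ = no λ ()

    edge? : ∀ x y → Dec (PetEdge n k x y)
    edge? (u i) (u j) = map′ (λ { refl → outer i }) (λ { (outer _) → refl }) (j Fin.≟ i ⊕ 1)
    edge? (u i) (v j) = map′ (λ { refl → spoke i }) (λ { (spoke _) → refl }) (i Fin.≟ j)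
    edge? (v _) (u _) = no λ ()
    edge? (v i) (v j) = map′ (λ { refl → inner i }) (λ { (inner _) → refl }) (j Fin.≟ i ⊕ k)

    adj? : ∀ x y → Dec (Adj P x y)
    adj? x y = map′ [ fwd , bwd ]′ (λ { (fwd e) → inj₁ e ; (bwd e) → inj₂ e })
      (edge? x y ⊎-dec edge? y x)

  pet-oddGirth : ∀ {ℓ} → OddClosedWalk P ℓ →
    ∃[ g ] IsOddGirth P g × OddClosedWalk P g × (∀ ℓ → OddClosedWalk P ℓ → g ≤ ℓ)
  pet-oddGirth = oddGirth-exists search _≟ᵥ_ adj?

-- Rational bounds

-- Unnormalised fractions compare by cross-multiplication, unaffected by reduction to lowest terms.
fromℚᵘ-mono-≤ : ∀ {p q} → p ℚᵘ.≤ q → fromℚᵘ p ≤ℚ fromℚᵘ q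
fromℚᵘ-mono-≤ {p} {q} p≤q = toℚᵘ-cancel-≤ (begin
  toℚᵘ (fromℚᵘ p)  ≃⟨ toℚᵘ-fromℚᵘ p ⟩
  p                ≤⟨ p≤q ⟩
  q                ≃⟨ toℚᵘ-fromℚᵘ q ⟨
  toℚᵘ (fromℚᵘ q)  ∎)
  where open ℚᵘ.≤-Reasoning

fromℕ-mono-≤ : ∀ {a b} → a ≤ b → fromℕ a ≤ℚ fromℕ b
fromℕ-mono-≤ {a} {b} a≤b = fromℚᵘ-mono-≤ {mkℚᵘ (+ a) 0} {mkℚᵘ (+ b) 0}
  (*≤* (ℤ.*-monoʳ-≤-nonNeg 1ℤ (+≤+ a≤b)))

n/k≤fromℕ : ∀ n k g .{{_ : NonZero k}} → n ≤ g * k → + n / k ≤ℚ fromℕ g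
n/k≤fromℕ n k@(suc k′) g n≤gk = fromℚᵘ-mono-≤ {mkℚᵘ (+ n) k′} {mkℚᵘ (+ g) 0} (*≤* (begin
  + n ℤ.* 1ℤ     ≡⟨ ℤ.*-identityʳ (+ n) ⟩
  + n            ≤⟨ +≤+ n≤gk ⟩
  + (g * k)      ≡⟨ ℤ.pos-* g k ⟩
  + g ℤ.* + k    ∎))
  where open ℤ.≤-Reasoning

fromℕ≤n/k*p+b : ∀ n k p b g .{{_ : NonZero k}} → g * k ≤ n * p + b * k →
                fromℕ g ≤ℚ (+ n / k) *ℚ fromℕ p +ℚ fromℕ b
fromℕ≤n/k*p+b n k@(suc k′) p b g bound = toℚᵘ-cancel-≤ (begin
  toℚᵘ (fromℕ g)                                           ≃⟨ toℚᵘ-fromℚᵘ (mkℚᵘ (+ g) 0) ⟩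
  mkℚᵘ (+ g) 0                                             ≤⟨ *≤* cross ⟩
  mkℚᵘ (+ n) k′ ℚᵘ.* mkℚᵘ (+ p) 0 ℚᵘ.+ mkℚᵘ (+ b) 0        ≃⟨ ℚᵘ.+-cong (ℚᵘ.*-cong
      (toℚᵘ-fromℚᵘ (mkℚᵘ (+ n) k′)) (toℚᵘ-fromℚᵘ (mkℚᵘ (+ p) 0))) (toℚᵘ-fromℚᵘ (mkℚᵘ (+ b) 0)) ⟨
  toℚᵘ (+ n / k) ℚᵘ.* toℚᵘ (fromℕ p) ℚᵘ.+ toℚᵘ (fromℕ b)   ≃⟨ ℚᵘ.+-congˡ (toℚᵘ (fromℕ b))
      (toℚᵘ-homo-* (+ n / k) (fromℕ p)) ⟨
  toℚᵘ ((+ n / k) *ℚ fromℕ p) ℚᵘ.+ toℚᵘ (fromℕ b)          ≃⟨ toℚᵘ-homo-+ ((+ n / k) *ℚ fromℕ p) (fromℕ b) ⟨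
  toℚᵘ ((+ n / k) *ℚ fromℕ p +ℚ fromℕ b)                   ∎)
  where
  open ℚᵘ.≤-Reasoning
  -- The factors `1` are the denominators of the natural numbers, left in place by unnormalised
  -- arithmetic.
  cross : + g ℤ.* + (suc k′ * 1 * 1) ℤ.≤ (+ n ℤ.* + p ℤ.* 1ℤ ℤ.+ + b ℤ.* + (suc k′ * 1)) ℤ.* 1ℤ
  cross = subst₂ ℤ._≤_ lhs rhs (+≤+ bound)
    where
    lhs : + (g * k) ≡ + g ℤ.* + (suc k′ * 1 * 1)
    lhs = trans (ℤ.pos-* g k)
      (cong (λ t → + g ℤ.* + t) (sym (trans (*-identityʳ (k * 1)) (*-identityʳ k))))
    rhs : + (n * p + b * k) ≡ (+ n ℤ.* + p ℤ.* 1ℤ ℤ.+ + b ℤ.* + (suc k′ * 1)) ℤ.* 1ℤ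
    rhs = sym (trans (ℤ.*-identityʳ _) (cong₂ ℤ._+_
      (trans (ℤ.*-identityʳ _) (sym (ℤ.pos-* n p)))
      (trans (cong (λ t → + b ℤ.* + t) (*-identityʳ k)) (sym (ℤ.pos-* b k)))))

-- Bounds according to the parity of `k`

par-odd : ∀ {k} → ¬ 2 ∣ k → par k ≡ 1
par-odd {k} 2∤k with k % 2 in eq | m%n<n k 2
... | 0           | _              = contradiction (m%n≡0⇒n∣m k 2 eq) 2∤k
... | 1           | _              = refl
... | suc (suc _) | s≤s (s≤s ())

GirthBounds : (n k : ℕ) .{{_ : NonZero k}} → ℕ → Set
GirthBounds n k g = g ≡ k + 3 ⊎
  (((+ n / k) ⊔ℚ fromℕ (gcd n (k ∸ 1) ⊓ gcd n (k + 1) + 2)) ≤ℚ fromℕ g ×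
  fromℕ g ≤ℚ (((+ n / k) *ℚ fromℕ (par k)) +ℚ fromℕ (k + 1)))

module _ {n k : ℕ} .{{_ : NonZero k}} (2<2k : 2 < 2 * k) (2k≤n : 2 * k ≤ n) where

  private
    P = Pet n k 2<2k 2k≤n

    bounds : ∀ {g} → OddClosedWalk P g → n ≤ g * k → g * k ≤ n * par k + (k + 1) * k →
             GirthBounds n k g
    bounds {g} (odd , _ , w) n≤gk upper = inj₂
      ( ⊔-lub (n/k≤fromℕ n k g n≤gk) (fromℕ-mono-≤ (gcd-bound 2<2k 2k≤n odd w))
      , fromℕ≤n/k*p+b n k (par k) (k + 1) g upper)

  k-even⇒bounds : ∀ {g} → 2 ∣ k → OddClosedWalk P g → g ≤ k + 3 → GirthBounds n k g
  k-even⇒bounds {g} 2∣k W@(odd , _ , w) g≤k+3 = [ short , inj₁ ]′ (m≤n⇒m<n∨m≡n g≤k+3)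
    where
    short : g < k + 3 → GirthBounds n k g
    short g<k+3 = bounds W
      ([ (λ n≤gk → n≤gk) , (λ (_ , k+3≤g) → contradiction k+3≤g (<⇒≱ g<k+3)) ]′
        (winding-bound 2<2k 2k≤n odd w))
      (≤-trans (*-monoˡ-≤ k g≤k+1) (m≤n+m ((k + 1) * k) (n * par k)))
      where
      -- `g` and `k + 3` are both odd, so strict inequality leaves a gap of at least 2.
      g≤k+1 : g ≤ k + 1
      g≤k+1 = +-cancelʳ-≤ 2 g (k + 1) (subst (g + 2 ≤_) (sym (+-assoc k 1 2))
        (odd<odd⇒2+≤ odd (proj₁ (k-even⇒oddClosedWalk 2<2k 2k≤n 2∣k)) g<k+3))

  k-odd⇒bounds : ∀ {g} → ¬ 2 ∣ k → OddClosedWalk P g → g ≤ n /ℕ k + (1 + (n % k + 1)) →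
                 GirthBounds n k g
  k-odd⇒bounds {g} 2∤k W@(odd , _ , w) g≤ = bounds W
    ([ (λ n≤gk → n≤gk) , (λ (2∣k , _) → contradiction 2∣k 2∤k) ]′ (winding-bound 2<2k 2k≤n odd w))
    (begin
      g * k                             ≤⟨ *-monoˡ-≤ k g≤ ⟩
      -- The remainder is below `k`, so its successor is at most `k`.
      (n /ℕ k + (1 + (n % k + 1))) * k  ≤⟨ *-monoˡ-≤ k (+-monoʳ-≤ (n /ℕ k) (+-monoˡ-≤ 1 (m%n<n n k))) ⟩
      (n /ℕ k + (k + 1)) * k            ≡⟨ *-distribʳ-+ k (n /ℕ k) (k + 1) ⟩
      n /ℕ k * k + (k + 1) * k          ≤⟨ +-monoˡ-≤ ((k + 1) * k) (m/n*n≤m n k) ⟩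
      n + (k + 1) * k                   ≡⟨ cong (λ t → t + (k + 1) * k) (*-identityʳ n) ⟨
      n * 1 + (k + 1) * k               ≡⟨ cong (λ t → n * t + (k + 1) * k) (par-odd 2∤k) ⟨
      n * par k + (k + 1) * k           ∎)
    where open ≤-Reasoning

  -- The given walk is used twice: it starts the search for the odd girth and bounds the result by
  -- `m`.
  oddGirth-bounds : ∀ {m} → OddClosedWalk P m →
                    (∀ {g} → OddClosedWalk P g → g ≤ m → GirthBounds n k g) →
                    ∃[ g ] (IsOddGirth P g × GirthBounds n k g)
  oddGirth-bounds W bound =
    let g , girth , Wg , shortest = pet-oddGirth 2<2k 2k≤n W
    in g , girth , bound Wg (shortest _ W)

theorem2 : (n k : ℕ) .{{_ : NonZero k}} (2<2k : 2 < 2 * k) (2k≤n : 2 * k ≤ n) →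
    ¬ Bipartite (Pet n k 2<2k 2k≤n) →
    ∃[ g ] (IsOddGirth (Pet n k 2<2k 2k≤n) g ×
    (g ≡ k + 3 ⊎
    (((+ n / k) ⊔ℚ fromℕ (gcd n (k ∸ 1) ⊓ gcd n (k + 1) + 2)) ≤ℚ fromℕ g ×
    fromℕ g ≤ℚ (((+ n / k) *ℚ fromℕ (par k)) +ℚ fromℕ (k + 1)))))
theorem2 n k 2<2k 2k≤n ¬bipartite = by-parity (2 ∣? k) (2 ∣? n)
  where
  by-parity : Dec (2 ∣ k) → Dec (2 ∣ n) →
              ∃[ g ] (IsOddGirth (Pet n k 2<2k 2k≤n) g × GirthBounds n k g)
  by-parity (yes 2∣k) _ =
    oddGirth-bounds 2<2k 2k≤n (k-even⇒oddClosedWalk 2<2k 2k≤n 2∣k) (k-even⇒bounds 2<2k 2k≤n 2∣k)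
  -- Odd `k` with even `n` is the case that the non-bipartiteness hypothesis excludes.
  by-parity (no 2∤k) (yes 2∣n) = contradiction (bipartite 2<2k 2k≤n 2∣n 2∤k) ¬bipartite
  by-parity (no 2∤k) (no 2∤n) =
    oddGirth-bounds 2<2k 2k≤n (k-odd⇒oddClosedWalk 2<2k 2k≤n 2∤k 2∤n) (k-odd⇒bounds 2<2k 2k≤n 2∤k)
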